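{- Let $n>2$ and $t>2$ be two positive integers. Then \[\varphi(P_n \boxdot S_t) = \begin{cases} 2n-1, & \text{if } n\leq \frac {t+3}2,\\ t+2, & \text{if }n=\left\lceil\frac {t+4}2\right\rceil,\\ t+3, & \text{if } \left\lceil\frac {t+4}2\right\rceil < n \leq t+4,\\ n-1, & \text{if } t+4<n\leq 2t+5,\\ 2t+5, & \text{otherwise}. \end{cases}\]
   Context: All graphs are finite and simple. $P_n$ denotes the path with $n$ vertices and $S_t$ denotes the star with $t$ leaves (so it has $t+1$ vertices). The subdivision graph $S(G)$ of a graph $G$ is obtained by inserting one new vertex into every edge of $G$. For graphs $G$ and $H$, with $V(G)=\{u_0,\ldots,u_{m-1}\}$, the subdivision-vertex neighbourhood corona (SVN corona) $G\boxdot H$ is the graph obtained from $S(G)$ by adding $m$ vertex-disjoint copies of $H$ (one for each $u_i$) and joining, for each $i$, every vertex of $N_{S(G)}(u_i)$ (the neighbourhood of $u_i$ in $S(G)$) to every vertex of the copy of $H$ associated with $u_i$. A $b$-chromatic coloring of a graph with $k$ colors is a proper coloring with colors $0,\ldots,k-1$ such that, for each color $i$, there is a vertex (a $b$-vertex) of color $i$ having, for each color $j\neq i$, a neighbour of color $j$. The $b$-chromatic number $\varphi(G)$ is the maximum $k$ for which $G$ has a $b$-chromatic coloring with $k$ colors. -}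

module Defs where

open import Data.Empty using (⊥)
open import Data.Empty.Irrelevant using (⊥-elim)
open import Data.Fin using (Fin; zero; suc; toℕ; _<_)
open import Data.Fin.Properties using (+↔⊎; *↔×; inj⇒≟; _<?_)
open import Data.Irrelevant using ([_])
open import Data.Nat using (ℕ; zero; suc; _+_; _*_; _≤_; _≟_)
open import Data.Nat.Properties using (1+n≢n)
open import Data.Product using (_×_; _,_; proj₁; proj₂; ∃; ∃-syntax)
open import Data.Product.Function.NonDependent.Propositional using (_×-↔_)
open import Data.Refinement using (Refinement; value; Refinement-syntax)
  renaming (_,_ to _,ᵣ_)
open import Data.Sum using (_⊎_; inj₁; inj₂; swap)
open import Data.Sum.Function.Propositional using (_⊎-↔_)
open import Function using (_∘_; _↔_; Inverse; mk↔ₛ′)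
open import Function.Properties.Inverse using (↔-refl; ↔-sym; ↔-trans; ↔⇒↣)
open import Relation.Binary using (Decidable; DecidableEquality; Symmetric)
open import Relation.Binary.PropositionalEquality
  using (_≡_; _≢_; refl; sym; cong; subst)
open import Relation.Nullary using (¬_; yes; no)
open import Relation.Nullary.Decidable using (_×-dec_; _⊎-dec_)
import Relation.Unary as U

------------------------------------------------------------------------
-- Finite simple graphs

record Graph : Set₁ where
  infix 4 _~_ _~?_
  field
    V       : Set
    order   : ℕ
    finite  : V ↔ Fin order
    _~_     : V → V → Set
    _~?_    : Decidable _~_
    ~-sym   : Symmetric _~_
    ~-irrefl : ∀ {u} → ¬ (u ~ u)

  index : V → Fin order
  index = Inverse.to finite

  _≟ⱽ_ : DecidableEquality V
  _≟ⱽ_ = inj⇒≟ (↔⇒↣ finite)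

  -- An unordered pair {u , v} of adjacent vertices is represented by its
  -- unique ordering compatible with the enumeration of V; the proof
  -- component is irrelevant, so each edge occurs exactly once.
  IsEdge : V × V → Set
  IsEdge (u , v) = index u < index v × u ~ v

  isEdge? : U.Decidable IsEdge
  isEdge? (u , v) = (index u <? index v) ×-dec (u ~? v)

  Edge : Set
  Edge = [ e ∈ V × V ∣ IsEdge e ]

  _∈ᴱ_ : V → Edge → Set
  u ∈ᴱ e = u ≡ proj₁ (value e) ⊎ u ≡ proj₂ (value e)

  _∈ᴱ?_ : Decidable _∈ᴱ_
  u ∈ᴱ? e = (u ≟ⱽ proj₁ (value e)) ⊎-dec (u ≟ⱽ proj₂ (value e))

------------------------------------------------------------------------
-- Decidable subsets of finite types are finite

private
  refinementFin : ∀ n {P : Fin n → Set} → U.Decidable P →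
                  ∃[ m ] (Refinement (Fin n) P ↔ Fin m)
  refinementFin zero    P? =
    0 , mk↔ₛ′ (λ { (() ,ᵣ _) }) (λ ()) (λ ()) (λ { (() ,ᵣ _) })
  refinementFin (suc n) {P} P? with refinementFin n (P? ∘ suc) | P? zero
  ... | m , eq | yes p = suc m , mk↔ₛ′ to from to∘from from∘to
    where
    to : Refinement (Fin (suc n)) P → Fin (suc m)
    to (zero  ,ᵣ _) = zero
    to (suc i ,ᵣ q) = suc (Inverse.to eq (i ,ᵣ q))

    shift : Refinement (Fin n) (P ∘ suc) → Refinement (Fin (suc n)) P
    shift (i ,ᵣ q) = suc i ,ᵣ q

    from : Fin (suc m) → Refinement (Fin (suc n)) P
    from zero    = zero ,ᵣ [ p ]
    from (suc k) = shift (Inverse.from eq k)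

    to∘from : ∀ k → to (from k) ≡ k
    to∘from zero    = refl
    to∘from (suc k) = cong suc (Inverse.strictlyInverseˡ eq k)

    from∘to : ∀ x → from (to x) ≡ x
    from∘to (zero  ,ᵣ _) = refl
    from∘to (suc i ,ᵣ q) =
      cong shift (Inverse.strictlyInverseʳ eq (i ,ᵣ q))
  ... | m , eq | no ¬p = m , ↔-trans (mk↔ₛ′ to from (λ _ → refl) from∘to) eq
    where
    to : Refinement (Fin (suc n)) P → Refinement (Fin n) (P ∘ suc)
    to (zero  ,ᵣ [ q ]) = ⊥-elim (¬p q)
    to (suc i ,ᵣ q)     = i ,ᵣ q

    from : Refinement (Fin n) (P ∘ suc) → Refinement (Fin (suc n)) P
    from (i ,ᵣ q) = suc i ,ᵣ q

    from∘to : ∀ x → from (to x) ≡ x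
    from∘to (zero  ,ᵣ [ q ]) = ⊥-elim (¬p q)
    from∘to (suc i ,ᵣ q)     = refl

  refinementFinite : ∀ {n} {A : Set} {P : A → Set} → A ↔ Fin n →
                     U.Decidable P → ∃[ m ] (Refinement A P ↔ Fin m)
  refinementFinite {n} {A} {P} A↔ P? =
    let m , eq = refinementFin n (P? ∘ Inverse.from A↔)
    in m , ↔-trans (mk↔ₛ′ to from to∘from from∘to) eq
    where
    Q : Fin n → Set
    Q = P ∘ Inverse.from A↔

    cong-value : ∀ {B : Set} {R : B → Set} {x y : Refinement B R} →
                 value x ≡ value y → x ≡ y
    cong-value refl = refl

    to : Refinement A P → Refinement (Fin n) Q
    to (a ,ᵣ [ p ]) =
      Inverse.to A↔ a ,ᵣ [ subst P (sym (Inverse.strictlyInverseʳ A↔ a)) p ]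

    from : Refinement (Fin n) Q → Refinement A P
    from (i ,ᵣ [ q ]) = Inverse.from A↔ i ,ᵣ [ q ]

    to∘from : ∀ y → to (from y) ≡ y
    to∘from (i ,ᵣ [ q ]) = cong-value (Inverse.strictlyInverseˡ A↔ i)

    from∘to : ∀ x → from (to x) ≡ x
    from∘to (a ,ᵣ [ p ]) = cong-value (Inverse.strictlyInverseʳ A↔ a)

edge-finite : ∀ G → ∃[ m ] (Graph.Edge G ↔ Fin m)
edge-finite G = refinementFinite (↔-trans (finite ×-↔ finite) (↔-sym *↔×)) isEdge?
  where open Graph G

------------------------------------------------------------------------
-- Paths and stars

path : ℕ → Graph
path n = record
  { V        = Fin n
  ; order    = n
  ; finite   = ↔-refl
  ; _~_      = λ i j → toℕ j ≡ suc (toℕ i) ⊎ toℕ i ≡ suc (toℕ j)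
  ; _~?_     = λ i j → (toℕ j ≟ suc (toℕ i)) ⊎-dec (toℕ i ≟ suc (toℕ j))
  ; ~-sym    = swap
  ; ~-irrefl = λ { (inj₁ eq) → 1+n≢n (sym eq) ; (inj₂ eq) → 1+n≢n (sym eq) }
  }

-- The centre is zero, the leaves are the suc j.
data StarAdj {t : ℕ} : Fin (suc t) → Fin (suc t) → Set where
  centre~leaf : ∀ j → StarAdj zero (suc j)
  leaf~centre : ∀ j → StarAdj (suc j) zero

star : ℕ → Graph
star t = record
  { V        = Fin (suc t)
  ; order    = suc t
  ; finite   = ↔-refl
  ; _~_      = StarAdj
  ; _~?_     = λ { zero    zero    → no λ ()
                 ; zero    (suc j) → yes (centre~leaf j)
                 ; (suc j) zero    → yes (leaf~centre j)
                 ; (suc _) (suc _) → no λ ()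
                 }
  ; ~-sym    = λ { (centre~leaf j) → leaf~centre j
                 ; (leaf~centre j) → centre~leaf j
                 }
  ; ~-irrefl = λ ()
  }

------------------------------------------------------------------------
-- Subdivision graph: inj₁ u is an original vertex, inj₂ e is the vertex
-- inserted into the edge e.

module _ (G : Graph) where
  open Graph G

  SubdivisionAdj : V ⊎ Edge → V ⊎ Edge → Set
  SubdivisionAdj (inj₁ u) (inj₂ e) = u ∈ᴱ e
  SubdivisionAdj (inj₂ e) (inj₁ u) = u ∈ᴱ e
  SubdivisionAdj (inj₁ _) (inj₁ _) = ⊥
  SubdivisionAdj (inj₂ _) (inj₂ _) = ⊥

  subdivision : Graph
  subdivision = record
    { V        = V ⊎ Edge
    ; order    = order + proj₁ (edge-finite G)
    ; finite   = ↔-trans (finite ⊎-↔ proj₂ (edge-finite G)) (↔-sym +↔⊎)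
    ; _~_      = SubdivisionAdj
    ; _~?_     = λ { (inj₁ u) (inj₂ e) → u ∈ᴱ? e
                   ; (inj₂ e) (inj₁ u) → u ∈ᴱ? e
                   ; (inj₁ _) (inj₁ _) → no λ ()
                   ; (inj₂ _) (inj₂ _) → no λ ()
                   }
    ; ~-sym    = λ { {inj₁ _} {inj₂ _} p → p
                   ; {inj₂ _} {inj₁ _} p → p
                   }
    ; ~-irrefl = λ { {inj₁ _} () ; {inj₂ _} () }
    }

------------------------------------------------------------------------
-- Subdivision-vertex neighbourhood corona: inj₁ x is a vertex of S(G),
-- inj₂ (u , a) is the vertex a in the copy of H associated with u ∈ V(G).

module _ (G H : Graph) where
  private
    module G = Graph G
    module H = Graph H
    module S = Graph (subdivision G)

  SVNCoronaAdj : S.V ⊎ (G.V × H.V) → S.V ⊎ (G.V × H.V) → Set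
  SVNCoronaAdj (inj₁ x)       (inj₁ y)       = x S.~ y
  SVNCoronaAdj (inj₂ (u , a)) (inj₂ (v , b)) = u ≡ v × a H.~ b
  SVNCoronaAdj (inj₁ x)       (inj₂ (u , _)) = inj₁ u S.~ x
  SVNCoronaAdj (inj₂ (u , _)) (inj₁ x)       = inj₁ u S.~ x

  infixl 6 _⊡_
  _⊡_ : Graph
  _⊡_ = record
    { V        = S.V ⊎ (G.V × H.V)
    ; order    = S.order + G.order * H.order
    ; finite   = ↔-trans
        (S.finite ⊎-↔ ↔-trans (G.finite ×-↔ H.finite) (↔-sym *↔×))
        (↔-sym +↔⊎)
    ; _~_      = SVNCoronaAdj
    ; _~?_     = λ { (inj₁ x)       (inj₁ y)       → x S.~? y
                   ; (inj₂ (u , a)) (inj₂ (v , b)) → (u G.≟ⱽ v) ×-dec (a H.~? b)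
                   ; (inj₁ x)       (inj₂ (u , _)) → inj₁ u S.~? x
                   ; (inj₂ (u , _)) (inj₁ x)       → inj₁ u S.~? x
                   }
    ; ~-sym    = λ { {inj₁ x} {inj₁ y} p           → S.~-sym {x} {y} p
                   ; {inj₂ _} {inj₂ _} (u≡v , a~b) → sym u≡v , H.~-sym a~b
                   ; {inj₁ _} {inj₂ _} p           → p
                   ; {inj₂ _} {inj₁ _} p           → p
                   }
    ; ~-irrefl = λ { {inj₁ x} p         → S.~-irrefl {x} p
                   ; {inj₂ _} (_ , a~a) → H.~-irrefl a~a
                   }
    }

------------------------------------------------------------------------
-- b-chromatic colourings

module _ (G : Graph) where
  open Graph G

  IsBVertex : ∀ {k} → (V → Fin k) → V → Set
  IsBVertex c v = ∀ j → j ≢ c v → ∃[ w ] (v ~ w × c w ≡ j)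

  record BColouring (k : ℕ) : Set where
    field
      colour  : V → Fin k
      proper  : ∀ {u v} → u ~ v → colour u ≢ colour v
      bVertex : ∀ i → ∃[ v ] (colour v ≡ i × IsBVertex colour v)

  -- φ(G) = k
  IsBChromaticNumber : ℕ → Set
  IsBChromaticNumber k = BColouring k × (∀ k′ → BColouring k′ → k′ ≤ k)

{-# OPTIONS --safe #-}
module Submission where

-- Upper bounds: a b-colouring with k colours needs k b-vertices of degree at least k − 1.  Only the
-- inserted vertices e_i (degree 2t + 4), the centres of the inner copies (degree t + 2) and those of
-- the two end copies (degree t + 1) have degree above 3, and counting them gives every upper bound.
--
-- Lower bounds: for k ≤ n − 1 colour e_i with i mod k and the copy of u_i with i + d mod k, where d
-- ranges over 1, 3, 5, … and k − 2.  For k ≥ n give the e_i distinct colours, spread the remaining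
-- colours over the centres, and let the leaves of each copy run through the colours used neither by
-- their centre nor by the adjacent e_i.

open import Defs
open import Data.Bool using (if_then_else_; _∧_)
open import Data.Empty using (⊥-elim)
open import Data.Fin using (Fin; zero; suc; toℕ; fromℕ<; join; splitAt; combine)
open import Data.Fin.Properties
  using (injective⇒≤; splitAt-join; toℕ-injective; toℕ<n; toℕ-fromℕ<; combine-injective)
  renaming (_≟_ to _≟ᶠ_; suc-injective to sucᶠ-injective)
open import Data.Irrelevant using ([_])
open import Data.Nat
open import Data.Nat.DivMod
open import Data.Nat.Properties
open import Data.Product using (_×_; _,_; proj₁; proj₂; ∃-syntax)
open import Data.Refinement using (value) renaming (_,_ to _,ᵣ_)
open import Data.Sum using (_⊎_; inj₁; inj₂; [_,_]′)
open import Data.Sum.Properties using (inj₁-injective; inj₂-injective)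
open import Function using (_∘_)
open import Relation.Binary.Definitions using (tri<; tri≈; tri>)
open import Relation.Binary.PropositionalEquality
open import Relation.Nullary using (yes; no)
open import Relation.Nullary.Decidable using (⌊_⌋; recompute)

private variable a b d k : ℕ

-- Counting b-vertices through injective codes

join-injective : {p q : Fin a ⊎ Fin b} → join a b p ≡ join a b q → p ≡ q
join-injective {a} {b} {p} {q} eq =
  trans (sym (splitAt-join a b p)) (trans (cong (splitAt a) eq) (splitAt-join a b q))

fromℕ<-cancel : ∀ {x y n} .{p : x < n} .{q : y < n} → fromℕ< p ≡ fromℕ< q → x ≡ y
fromℕ<-cancel {p = p} {q} eq =
  trans (sym (toℕ-fromℕ< p)) (trans (cong toℕ eq) (toℕ-fromℕ< q))

module _ {G : Graph} (β : BColouring G k) where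
  open Graph G
  open BColouring β

  -- Every colour but that of `v` is borne by some neighbour. Sending the own colour to `zero` and
  -- any other to the code of such a neighbour injects the colours into `Fin (suc d)`.
  bVertex⇒degree : ∀ {v} (code : ∀ w → v ~ w → Fin d) →
    (∀ {w x} (p : v ~ w) (q : v ~ x) → code w p ≡ code x q → w ≡ x) →
    IsBVertex G colour v → k ≤ suc d
  bVertex⇒degree {d} {v} code code-inj isB = injective⇒≤ (f-inj _ _)
    where
    f : Fin k → Fin (suc d)
    f j with j ≟ᶠ colour v
    ... | yes _  = zero
    ... | no j≢v = (let w , v~w , _ = isB j j≢v in suc (code w v~w))

    f-inj : ∀ i j → f i ≡ f j → i ≡ j
    f-inj i j eq with i ≟ᶠ colour v | j ≟ᶠ colour v
    f-inj i j eq | yes p | yes q = trans p (sym q)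
    f-inj i j () | yes p | no q
    f-inj i j () | no p  | yes q
    f-inj i j eq | no p  | no q  =
      let w , v~w , cw≡i = isB i p
          x , v~x , cx≡j = isB j q
      in trans (sym cw≡i)
           (trans (cong colour (code-inj v~w v~x (sucᶠ-injective eq))) cx≡j)

  -- Chosen b-vertices of distinct colours are distinct, so a code that separates b-vertices
  -- separates colours.
  bVertices≤ : (code : ∀ {v} → IsBVertex G colour v → Fin a ⊎ Fin b) →
    (∀ {v w} (p : IsBVertex G colour v) (q : IsBVertex G colour w) →
      code p ≡ code q → v ≡ w) →
    k ≤ a + b
  bVertices≤ {a} {b} code code-inj = injective⇒≤ λ {i} {j} eq →
    let v , cv≡i , v-isB = bVertex i
        w , cw≡j , w-isB = bVertex j
    in trans (sym cv≡i)
         (trans (cong colour (code-inj v-isB w-isB (join-injective eq))) cw≡j)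
    where
    f : Fin k → Fin (a + b)
    f i = join a b (code (proj₂ (proj₂ (bVertex i))))

pattern original u = inj₁ (inj₁ u)
pattern inserted e = inj₁ (inj₂ e)
pattern centre u   = inj₂ (u , zero)
pattern leaf u j   = inj₂ (u , suc j)

-- Degrees in the corona and the upper bounds

module PathEdge (m : ℕ) where
  open Graph (path (suc m)) public using (Edge; _∈ᴱ_; isEdge?)

  left right : Edge → Fin (suc m)
  left  e = proj₁ (value e)
  right e = proj₂ (value e)

  right≡1+left : ∀ e → toℕ (right e) ≡ suc (toℕ (left e))
  right≡1+left (uv ,ᵣ [ p ]) with recompute (isEdge? uv) p
  ... | _   , inj₁ eq = eq
  ... | u<v , inj₂ eq = ⊥-elim (<-asym u<v (≤-reflexive (sym eq)))

  left<m : ∀ e → toℕ (left e) < m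
  left<m e = s≤s⁻¹ (subst (_< suc m) (right≡1+left e) (toℕ<n (right e)))

  left-injective : ∀ {e f} → left e ≡ left f → e ≡ f
  left-injective {e} {f} eq = value-injective (cong₂ _,_ eq (toℕ-injective
    (trans (right≡1+left e) (trans (cong (suc ∘ toℕ) eq) (sym (right≡1+left f))))))
    where
    value-injective : ∀ {e f : Edge} → value e ≡ value f → e ≡ f
    value-injective refl = refl

  right-injective : ∀ {e f} → right e ≡ right f → e ≡ f
  right-injective {e} {f} eq = left-injective (toℕ-injective (suc-injective
    (trans (sym (right≡1+left e)) (trans (cong toℕ eq) (right≡1+left f)))))

  edge : ∀ {i} → i < m → Edge
  edge i<m = (fromℕ< (m<n⇒m<1+n i<m) , fromℕ< (s≤s i<m)) ,ᵣ
    [ subst₂ _<_ (sym l) (sym r) ≤-refl , inj₁ (trans r (cong suc (sym l))) ]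
    where
    l = toℕ-fromℕ< (m<n⇒m<1+n i<m)
    r = toℕ-fromℕ< (s≤s i<m)

  -- Separates the at most two edges at a vertex and, read the other way, the two endpoints of an
  -- edge.
  side : ∀ {u e} → u ∈ᴱ e → Fin 2
  side (inj₁ _) = zero
  side (inj₂ _) = suc zero

  side-injective : ∀ {u e f} (p : u ∈ᴱ e) (q : u ∈ᴱ f) → side {u} {e} p ≡ side {u} {f} q → e ≡ f
  side-injective (inj₁ p) (inj₁ q) _ = left-injective (trans (sym p) q)
  side-injective (inj₂ p) (inj₂ q) _ = right-injective (trans (sym p) q)

  IsEnd : Fin (suc m) → Set
  IsEnd u = toℕ u ≡ 0 ⊎ toℕ u ≡ m

  -- Two distinct edges at `u` would make it the right end of one, hence not of index 0, and the
  -- left end of the other, hence not of index `m`.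
  end-edge-unique : ∀ {u e f} → IsEnd u → u ∈ᴱ e → u ∈ᴱ f → e ≡ f
  end-edge-unique _ (inj₁ p) (inj₁ q) = left-injective (trans (sym p) q)
  end-edge-unique _ (inj₂ p) (inj₂ q) = right-injective (trans (sym p) q)
  end-edge-unique {e = e} {f} end (inj₁ p) (inj₂ q) = ⊥-elim (absurd end p q)
    where
    absurd : ∀ {u} → IsEnd u → u ≡ left e → u ≡ right f → _
    absurd (inj₁ u≡0) _ u≡r = 0≢1+n (trans (sym u≡0) (trans (cong toℕ u≡r) (right≡1+left f)))
    absurd (inj₂ u≡m) u≡l _ = <-irrefl (trans (cong toℕ (sym u≡l)) u≡m) (left<m e)
  end-edge-unique {u} {e} {f} end p@(inj₂ _) q@(inj₁ _) = sym (end-edge-unique {u} {f} {e} end q p)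

module Upper {m t k : ℕ} (β : BColouring (path (suc m) ⊡ star t) k) where
  open PathEdge m
  open BColouring β
  private
    G = path (suc m) ⊡ star t
  open Graph G using (V; _~_)

  isB : V → Set
  isB = IsBVertex G colour

  original-degree : ∀ {u} → isB (original u) → k ≤ 4
  original-degree {u} isB = ≤-trans (bVertex⇒degree β code code-inj isB) (n≤1+n 3)
    where
    code : ∀ w → original u ~ w → Fin 2
    code (inserted e) p = side {e = e} p

    code-inj : ∀ {w x} (p : original u ~ w) (q : original u ~ x) → code w p ≡ code x q → w ≡ x
    code-inj {inserted e} {inserted f} p q eq = cong (λ e → inserted e) (side-injective {u} {e} {f} p q eq)

  leaf-degree : ∀ {u j} → isB (leaf u j) → k ≤ 4
  leaf-degree {u} {j} = bVertex⇒degree β code code-inj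
    where
    code : ∀ w → leaf u j ~ w → Fin 3
    code (inserted e) p = suc (side {e = e} p)
    code (centre v) (refl , _) = zero
    code (leaf v _) (_ , ())

    code-inj : ∀ {w x} (p : leaf u j ~ w) (q : leaf u j ~ x) → code w p ≡ code x q → w ≡ x
    code-inj {inserted e} {inserted f} p q eq =
      cong (λ e → inserted e) (side-injective {u} {e} {f} p q (sucᶠ-injective eq))
    code-inj {centre _} {centre _} (refl , _) (refl , _) _ = refl
    code-inj {inserted e} {centre _} p (refl , _) ()
    code-inj {inserted e} {leaf _ _} p (_ , ())
    code-inj {centre _} {inserted _} (refl , _) q ()
    code-inj {centre _} {leaf _ _} _ (_ , ())
    code-inj {leaf _ _} (_ , ())

  centre-degree : ∀ {u} → isB (centre u) → k ≤ 3 + t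
  centre-degree {u} = bVertex⇒degree β code code-inj
    where
    code : ∀ w → centre u ~ w → Fin (2 + t)
    code (inserted e) (inj₁ _) = zero
    code (inserted e) (inj₂ _) = suc zero
    code (leaf v j) _ = suc (suc j)
    code (centre v) (_ , ())

    code-inj : ∀ {w x} (p : centre u ~ w) (q : centre u ~ x) → code w p ≡ code x q → w ≡ x
    code-inj {inserted e} {inserted f} (inj₁ p) (inj₁ q) eq =
      cong (λ e → inserted e) (left-injective (trans (sym p) q))
    code-inj {inserted e} {inserted f} (inj₂ p) (inj₂ q) eq =
      cong (λ e → inserted e) (right-injective (trans (sym p) q))
    code-inj {inserted e} {inserted f} (inj₁ p) (inj₂ q) ()
    code-inj {inserted e} {inserted f} (inj₂ p) (inj₁ q) ()
    code-inj {leaf _ _} {leaf _ _} (refl , _) (refl , _) refl = refl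
    code-inj {inserted e} {leaf _ _} (inj₁ p) _ ()
    code-inj {inserted e} {leaf _ _} (inj₂ p) _ ()
    code-inj {leaf _ _} {inserted _} _ (inj₁ q) ()
    code-inj {leaf _ _} {inserted _} _ (inj₂ q) ()
    code-inj {inserted e} {centre _} _ (_ , ())
    code-inj {leaf _ _} {centre _} _ (_ , ())
    code-inj {centre _} (_ , ())

  end-centre-degree : ∀ {u} → IsEnd u → isB (centre u) → k ≤ 2 + t
  end-centre-degree {u} end = bVertex⇒degree β code code-inj
    where
    code : ∀ w → centre u ~ w → Fin (1 + t)
    code (inserted e) _ = zero
    code (leaf v j) _ = suc j
    code (centre v) (_ , ())

    code-inj : ∀ {w x} (p : centre u ~ w) (q : centre u ~ x) → code w p ≡ code x q → w ≡ x
    code-inj {inserted e} {inserted f} p q _ =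
      cong (λ e → inserted e) (end-edge-unique {u} {e} {f} end p q)
    code-inj {leaf _ _} {leaf _ _} (refl , _) (refl , _) refl = refl
    code-inj {inserted e} {leaf _ _} _ _ ()
    code-inj {leaf _ _} {inserted _} _ _ ()
    code-inj {inserted e} {centre _} _ (_ , ())
    code-inj {leaf _ _} {centre _} _ (_ , ())
    code-inj {centre _} (_ , ())

  -- Each of the two endpoints contributes `2 + t` neighbours: the original vertex, its centre and
  -- its leaves.
  inserted-degree : ∀ {e} → isB (inserted e) → k ≤ 1 + 2 * (2 + t)
  inserted-degree {e} = bVertex⇒degree β code code-inj
    where
    code : ∀ w → inserted e ~ w → Fin (2 * (2 + t))
    code (original u) p = combine {n = 2 + t} (side {u} {e} p) zero
    code (inj₂ (u , a)) p = combine (side {u} {e} p) (suc a)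

    same-side : ∀ {u v} (p : u ∈ᴱ e) (q : v ∈ᴱ e) → side {u} {e} p ≡ side {v} {e} q → u ≡ v
    same-side (inj₁ refl) (inj₁ refl) _ = refl
    same-side (inj₂ refl) (inj₂ refl) _ = refl

    code-inj : ∀ {w x} (p : inserted e ~ w) (q : inserted e ~ x) → code w p ≡ code x q → w ≡ x
    code-inj {original u} {original v} p q eq
      with s≡s , _ ← combine-injective (side {u} {e} p) zero (side {v} {e} q) zero eq
      = cong (λ u → original u) (same-side p q s≡s)
    code-inj {inj₂ (u , a)} {inj₂ (v , b)} p q eq
      with s≡s , a≡b ← combine-injective (side {u} {e} p) (suc a) (side {v} {e} q) (suc b) eq
      = cong inj₂ (cong₂ _,_ (same-side p q s≡s) (sucᶠ-injective a≡b))
    code-inj {original u} {inj₂ (v , b)} p q eq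
      with () ← proj₂ (combine-injective (side {u} {e} p) zero (side {v} {e} q) (suc b) eq)
    code-inj {inj₂ (u , a)} {original v} p q eq
      with () ← proj₂ (combine-injective (side {u} {e} p) (suc a) (side {v} {e} q) zero eq)

  module _ (4<k : 4 < k) (κ : ∀ {u} → isB (centre u) → Fin b)
    (κ-inj : ∀ {u v} (p : isB (centre u)) (q : isB (centre v)) → κ p ≡ κ q → u ≡ v) where

    -- With more than four colours only inserted vertices and centres can be b-vertices. The former
    -- are counted by their left endpoints; `κ` counts the centres still eligible, which depends on
    -- the size of `k`.
    inserted-or-centre≤ : k ≤ m + b
    inserted-or-centre≤ = bVertices≤ β code code-inj
      where
      code : ∀ {v} → isB v → Fin m ⊎ Fin b
      code {original u} p = ⊥-elim (<⇒≱ 4<k (original-degree p))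
      code {leaf u j}   p = ⊥-elim (<⇒≱ 4<k (leaf-degree p))
      code {inserted e} p = inj₁ (fromℕ< (left<m e))
      code {centre u}   p = inj₂ (κ p)

      code-inj : ∀ {v w} (p : isB v) (q : isB w) → code p ≡ code q → v ≡ w
      code-inj {original u} p = ⊥-elim (<⇒≱ 4<k (original-degree p))
      code-inj {leaf u j}   p = ⊥-elim (<⇒≱ 4<k (leaf-degree p))
      code-inj {inserted e} {original u} p q = ⊥-elim (<⇒≱ 4<k (original-degree q))
      code-inj {inserted e} {leaf u j} p q = ⊥-elim (<⇒≱ 4<k (leaf-degree q))
      code-inj {centre e} {original u} p q = ⊥-elim (<⇒≱ 4<k (original-degree q))
      code-inj {centre e} {leaf u j} p q = ⊥-elim (<⇒≱ 4<k (leaf-degree q))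
      code-inj {inserted e} {inserted f} p q eq =
        cong (λ e → inserted e) (left-injective (toℕ-injective (fromℕ<-cancel (inj₁-injective eq))))
      code-inj {centre _} {centre _} p q eq = cong (λ u → centre u) (κ-inj p q (inj₂-injective eq))
      code-inj {inserted _} {centre _} p q ()
      code-inj {centre _} {inserted _} p q ()

  ≤inserted+centres : k ≤ 4 ⊎ k ≤ m + suc m
  ≤inserted+centres with k ≤? 4
  ... | yes k≤4 = inj₁ k≤4
  ... | no k≰4  = inj₂ (inserted-or-centre≤ (≰⇒> k≰4) (λ {u} _ → u) (λ _ _ eq → eq))

  ≤inserted : 1 < t → k ≤ 3 + t ⊎ k ≤ m
  ≤inserted 1<t with k ≤? 3 + t
  ... | yes k≤ = inj₁ k≤
  ... | no k≰  = inj₂ (subst (k ≤_) (+-identityʳ m)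
    (inserted-or-centre≤ {b = 0} (<-trans (+-monoʳ-< 3 1<t) (≰⇒> k≰))
      (⊥-elim ∘ k≰ ∘ centre-degree) (λ p → ⊥-elim (k≰ (centre-degree p)))))

  -- Beyond `2 + t` colours the two end centres drop out, which leaves the `m ∸ 1` inner ones.
  ≤inserted+inner : 1 < t → k ≤ 2 + t ⊎ k ≤ m + (m ∸ 1)
  ≤inserted+inner 1<t with k ≤? 2 + t
  ... | yes k≤ = inj₁ k≤
  ... | no k≰  = inj₂ (inserted-or-centre≤ (≤-<-trans (+-monoʳ-≤ 2 1<t) (≰⇒> k≰)) κ κ-inj)
    where
    inner : ∀ {u} → isB (centre u) → ∃[ i ] toℕ u ≡ suc i × i < m ∸ 1
    inner {u} p with toℕ u in u≡
    ... | zero  = ⊥-elim (k≰ (end-centre-degree (inj₁ u≡) p))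
    ... | suc i = i , refl , ∸-monoˡ-≤ 1
      (≤∧≢⇒< (subst (_≤ m) u≡ (s≤s⁻¹ (toℕ<n u))) λ eq → k≰ (end-centre-degree (inj₂ (trans u≡ eq)) p))

    κ : ∀ {u} → isB (centre u) → Fin (m ∸ 1)
    κ p = fromℕ< (proj₂ (proj₂ (inner p)))

    κ-inj : ∀ {u v} (p : isB (centre u)) (q : isB (centre v)) → κ p ≡ κ q → u ≡ v
    κ-inj p q eq = toℕ-injective (trans (proj₁ (proj₂ (inner p)))
      (trans (cong suc (fromℕ<-cancel eq)) (sym (proj₁ (proj₂ (inner q))))))

  ≤maxDegree : 0 < t → k ≤ 1 + 2 * (2 + t)
  ≤maxDegree 0<t with k ≤? 3 + t
  ... | yes k≤ = ≤-trans k≤ (s≤s (m≤m+n (2 + t) _))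
  ... | no k≰ = bound (proj₁ b₀) (proj₂ (proj₂ b₀))
    where
    -- Any colour would do: beyond `3 + t` colours its b-vertex can only be an inserted vertex.
    b₀ = bVertex (fromℕ< (≤-<-trans z≤n (≰⇒> k≰)))
    4≤3+t = +-monoʳ-≤ 3 0<t

    bound : ∀ v → isB v → k ≤ 1 + 2 * (2 + t)
    bound (original u) p = ⊥-elim (k≰ (≤-trans (original-degree p) 4≤3+t))
    bound (leaf u j)   p = ⊥-elim (k≰ (≤-trans (leaf-degree p) 4≤3+t))
    bound (centre u)   p = ⊥-elim (k≰ (centre-degree p))
    bound (inserted e) p = inserted-degree p

-- Colourings described by natural numbers

-- edge i is the colour of the vertex inserted between u_i and u_{i+1};
-- slot i 0, slot i 1 and slot i (2 + j) are the colours of u_i and of the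
-- centre and the leaves of its copy.
module Domination (m t : ℕ) (edge : ℕ → ℕ) (slot : ℕ → ℕ → ℕ) where

  EdgeSees : ℕ → ℕ → Set
  EdgeSees i y = ∃[ s ] s < 2 + t × (slot i s ≡ y ⊎ slot (suc i) s ≡ y)

  CentreSees : ℕ → ℕ → Set
  CentreSees i y = (∃[ j ] j < t × slot i (2 + j) ≡ y)
                 ⊎ (i < m × edge i ≡ y)
                 ⊎ (∃[ h ] i ≡ suc h × edge h ≡ y)

  Dominated : ℕ → ℕ → Set
  Dominated K x =
    (∃[ i ] i < m × edge i ≡ x × (∀ {y} → y < K → y ≢ x → EdgeSees i y)) ⊎
    (∃[ i ] i ≤ m × slot i 1 ≡ x × (∀ {y} → y < K → y ≢ x → CentreSees i y))

-- Working with functions on numbers avoids arithmetic in `Fin`. Vertex indices are bounded by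
-- hypotheses but slots are not, so the instances cap their slot colours.
record Scheme (m t K : ℕ) : Set where
  field
    edge  : ℕ → ℕ
    slot  : ℕ → ℕ → ℕ
    edge< : ∀ {i} → i < m → edge i < K
    slot< : ∀ {i} s → i ≤ m → slot i s < K
    slot≢edge     : ∀ {i} s → i < m → slot i s ≢ edge i
    slot-suc≢edge : ∀ {i} s → i < m → slot (suc i) s ≢ edge i
    centre≢leaf   : ∀ {i} j → i ≤ m → slot i 1 ≢ slot i (2 + j)

  open Domination m t edge slot public

  field
    dominating : ∀ {x} → x < K → Dominated K x

module _ {m t K : ℕ} (S : Scheme m t K) where
  open Scheme S
  open PathEdge m renaming (edge to mkEdge)
  private
    G = path (suc m) ⊡ star t
  open Graph G using (V; _~_)

  private
    ≤m : (u : Fin (suc m)) → toℕ u ≤ m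
    ≤m u = s≤s⁻¹ (toℕ<n u)

    hue : V → ℕ
    hue (original u)   = slot (toℕ u) 0
    hue (inserted e)   = edge (toℕ (left e))
    hue (inj₂ (u , a)) = slot (toℕ u) (suc (toℕ a))

    hue< : ∀ v → hue v < K
    hue< (original u)   = slot< 0 (≤m u)
    hue< (inserted e)   = edge< (left<m e)
    hue< (inj₂ (u , a)) = slot< _ (≤m u)

    slot≢ : ∀ {u e} s → u ∈ᴱ e → slot (toℕ u) s ≢ edge (toℕ (left e))
    slot≢ {e = e} s (inj₁ refl) = slot≢edge s (left<m e)
    slot≢ {e = e} s (inj₂ refl) eq = slot-suc≢edge s (left<m e)
      (trans (cong (λ i → slot i s) (sym (right≡1+left e))) eq)

    hue-proper : ∀ v w → v ~ w → hue v ≢ hue w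
    hue-proper (original u) (inserted e) p = slot≢ {u} {e} 0 p
    hue-proper (inserted e) (original u) p = slot≢ {u} {e} 0 p ∘ sym
    hue-proper (inserted e) (inj₂ (u , a)) p = slot≢ {u} {e} _ p ∘ sym
    hue-proper (inj₂ (u , a)) (inserted e) p = slot≢ {u} {e} _ p
    hue-proper (centre u) (leaf _ j) (refl , _) = centre≢leaf (toℕ j) (≤m u)
    hue-proper (leaf _ j) (centre u) (refl , _) = centre≢leaf (toℕ j) (≤m u) ∘ sym
    hue-proper (centre _) (centre _) (_ , ())
    hue-proper (leaf _ _) (leaf _ _) (_ , ())
    hue-proper (original _) (original _) ()
    hue-proper (inserted _) (inserted _) ()
    hue-proper (original _) (inj₂ _) ()
    hue-proper (inj₂ _) (original _) ()

    Sees : V → ℕ → Set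
    Sees v y = ∃[ w ] v ~ w × hue w ≡ y

    mkFin : ∀ {i} → i ≤ m → ∃[ u ] toℕ {suc m} u ≡ i
    mkFin i≤m = fromℕ< (s≤s i≤m) , toℕ-fromℕ< (s≤s i≤m)

    mkEdge-left : ∀ {i} (i<m : i < m) → toℕ (left (mkEdge i<m)) ≡ i
    mkEdge-left i<m = toℕ-fromℕ< _

    inserted-sees : ∀ {e u s y} → u ∈ᴱ e → s < 2 + t → slot (toℕ u) s ≡ y → Sees (inserted e) y
    inserted-sees {u = u} {zero}  u∈e _ eq = original u , u∈e , eq
    inserted-sees {u = u} {suc s} u∈e s< eq = inj₂ (u , fromℕ< (s≤s⁻¹ s<)) , u∈e ,
      trans (cong (slot (toℕ u) ∘ suc) (toℕ-fromℕ< (s≤s⁻¹ s<))) eq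

    edgeSees⇒ : ∀ {e y} → EdgeSees (toℕ (left e)) y → Sees (inserted e) y
    edgeSees⇒ {e} (s , s< , inj₁ eq) = inserted-sees {e} (inj₁ refl) s< eq
    edgeSees⇒ {e} (s , s< , inj₂ eq) = inserted-sees {e} (inj₂ refl) s<
      (trans (cong (λ i → slot i s) (right≡1+left e)) eq)

    centreSees⇒ : ∀ {u y} → CentreSees (toℕ u) y → Sees (centre u) y
    centreSees⇒ {u} (inj₁ (j , j<t , eq)) = leaf u (fromℕ< j<t) , (refl , centre~leaf _) ,
      trans (cong (slot (toℕ u) ∘ (2 +_)) (toℕ-fromℕ< j<t)) eq
    centreSees⇒ {u} (inj₂ (inj₁ (i<m , eq))) = inserted (mkEdge i<m) ,
      inj₁ (toℕ-injective (sym (mkEdge-left i<m))) , trans (cong edge (mkEdge-left i<m)) eq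
    centreSees⇒ {u} (inj₂ (inj₂ (h , u≡ , eq))) = inserted (mkEdge h<m) ,
      inj₂ (toℕ-injective (trans u≡ (sym (toℕ-fromℕ< (s≤s h<m))))) , trans (cong edge (mkEdge-left h<m)) eq
      where
      h<m : h < m
      h<m = subst (_≤ m) u≡ (≤m u)

    dominator : ∀ {x} → x < K → ∃[ v ] hue v ≡ x × (∀ {y} → y < K → y ≢ x → Sees v y)
    dominator x<K with dominating x<K
    ... | inj₁ (i , i<m , refl , sees) =
      inserted e , cong edge (mkEdge-left i<m) , λ y< y≢ →
        edgeSees⇒ {e} (subst (λ i → EdgeSees i _) (sym (mkEdge-left i<m)) (sees y< y≢))
      where e = mkEdge i<m
    ... | inj₂ (i , i≤m , refl , sees) with mkFin i≤m
    ... | u , refl = centre u , refl , λ y< y≢ → centreSees⇒ {u} (sees y< y≢)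

  scheme⇒bColouring : BColouring (path (suc m) ⊡ star t) K
  scheme⇒bColouring = record
    { colour  = colour
    ; proper  = λ {v} {w} v~w eq → hue-proper v w v~w (fromℕ<-cancel eq)
    ; bVertex = λ x →
        let v , v≡x , sees = dominator (toℕ<n x)
        in v , colour≡ v v≡x , λ y y≢v →
             let w , v~w , w≡y = sees (toℕ<n y) λ y≡x →
                   y≢v (toℕ-injective (trans y≡x (sym (trans (toℕ-fromℕ< (hue< v)) v≡x))))
             in w , v~w , colour≡ w w≡y
    }
    where
    colour : V → Fin K
    colour v = fromℕ< (hue< v)

    colour≡ : ∀ v {x} → hue v ≡ toℕ x → colour v ≡ x
    colour≡ v eq = toℕ-injective (trans (toℕ-fromℕ< (hue< v)) eq)

-- Colourings with at least n colours

Outside : ℕ → ℕ → ℕ → Set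
Outside lo w y = y < lo ⊎ lo + w ≤ y

-- For lo + w ≤ c, x ↦ skip lo w c x enumerates in increasing order the numbers outside [lo , lo + w)
-- other than c.
skip : (lo w c x : ℕ) → ℕ
skip lo w c x with x <? lo | x + w <? c
... | yes _ | _     = x
... | no _  | yes _ = x + w
... | no _  | no _  = suc (x + w)

skip-≤ : ∀ lo w c x → skip lo w c x ≤ suc (x + w)
skip-≤ lo w c x with x <? lo | x + w <? c
... | yes _ | _     = m≤n⇒m≤1+n (m≤m+n x w)
... | no _  | yes _ = n≤1+n _
... | no _  | no _  = ≤-refl

skip-outside : ∀ lo w c x → Outside lo w (skip lo w c x)
skip-outside lo w c x with x <? lo | x + w <? c
... | yes x<lo | _     = inj₁ x<lo
... | no x≮lo  | yes _ = inj₂ (+-monoˡ-≤ w (≮⇒≥ x≮lo))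
... | no x≮lo  | no _  = inj₂ (m≤n⇒m≤1+n (+-monoˡ-≤ w (≮⇒≥ x≮lo)))

skip≢ : ∀ {lo w c} x → lo + w ≤ c → skip lo w c x ≢ c
skip≢ {lo} {w} {c} x lo+w≤c eq with x <? lo | x + w <? c
... | yes x<lo | _       = <⇒≢ (<-≤-trans x<lo (≤-trans (m≤m+n lo w) lo+w≤c)) eq
... | no _     | yes lt  = <⇒≢ lt eq
... | no _     | no nlt  = <⇒≢ (s≤s (≮⇒≥ nlt)) (sym eq)

-- A colour below the interval is its own preimage; otherwise subtract `w`, and one more past `c`.
-- The final bound says that the first `K ∸ w ∸ 1` indices suffice, which fixes how many leaves are
-- needed.
skip-onto : ∀ {lo w c K y} → lo + w ≤ c → c < K → y < K → Outside lo w y → y ≢ c →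
            ∃[ x ] skip lo w c x ≡ y × 2 + (x + w) ≤ K
skip-onto {lo} {w} {c} {K} {y} lo+w≤c c<K y<K (inj₁ y<lo) y≢c = y , eq , bound
  where
  eq : skip lo w c y ≡ y
  eq with y <? lo
  ... | yes _   = refl
  ... | no y≮lo = ⊥-elim (y≮lo y<lo)

  bound : 2 + (y + w) ≤ K
  bound = ≤-trans (s≤s (≤-trans (+-monoˡ-≤ w y<lo) lo+w≤c)) c<K
skip-onto {lo} {w} {c} {K} {y} lo+w≤c c<K y<K (inj₂ lo+w≤y) y≢c with y <? c
... | yes y<c = y ∸ w , eq , subst (λ z → 2 + z ≤ K) (sym x+w≡y) (≤-trans (s≤s y<c) c<K)
  where
  x+w≡y : y ∸ w + w ≡ y
  x+w≡y = m∸n+n≡m (≤-trans (m≤n+m w lo) lo+w≤y)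

  eq : skip lo w c (y ∸ w) ≡ y
  eq with (y ∸ w) <? lo | (y ∸ w) + w <? c
  ... | yes lt | _      = ⊥-elim (<⇒≱ lt (m+n≤o⇒m≤o∸n lo lo+w≤y))
  ... | no _   | yes _  = x+w≡y
  ... | no _   | no nlt = ⊥-elim (nlt (subst (_< c) (sym x+w≡y) y<c))
... | no y≮c = y ∸ suc w , eq , subst (_≤ K) (cong suc (sym 1+x+w≡y)) y<K
  where
  c<y : c < y
  c<y = ≤∧≢⇒< (≮⇒≥ y≮c) (λ eq → y≢c (sym eq))

  lo+1+w≤y : lo + suc w ≤ y
  lo+1+w≤y = subst (_≤ y) (sym (+-suc lo w)) (≤-<-trans lo+w≤c c<y)

  1+x+w≡y : suc (y ∸ suc w + w) ≡ y
  1+x+w≡y = trans (sym (+-suc (y ∸ suc w) w)) (m∸n+n≡m (≤-trans (m≤n+m (suc w) lo) lo+1+w≤y))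

  eq : skip lo w c (y ∸ suc w) ≡ y
  eq with (y ∸ suc w) <? lo | (y ∸ suc w) + w <? c
  ... | yes lt | _      = ⊥-elim (<⇒≱ lt (m+n≤o⇒m≤o∸n lo lo+1+w≤y))
  ... | no _   | yes lt = ⊥-elim (<⇒≱ lt (s≤s⁻¹ (subst (c <_) (sym 1+x+w≡y) c<y)))
  ... | no _   | no _   = 1+x+w≡y

-- `centres` names the copy whose centre is the b-vertex of a colour `x ≥ m`. Its last component
-- gives that centre enough neighbours: any copy will do when `K ≤ 2 + t`, otherwise an inner one.
module Rigid {m t K off : ℕ} (2≤m : 2 ≤ m) (m<K : m < K) (4≤K : 4 ≤ K) (K≤3+t : K ≤ 3 + t)
  (m≤1+off : m ≤ suc off)
  (centres : ∀ {x} → m ≤ x → x < K → ∃[ i ] i ≤ m × off + i ≡ x × (K ≤ 2 + t ⊎ (0 < i × i < m)))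
  where

  -- The colours of the inserted vertices adjacent to u_i form the interval [lo i , lo i + width i).
  lo : ℕ → ℕ
  lo i = i ∸ 1

  width : ℕ → ℕ
  width zero = 1
  width (suc i) with suc i <? m
  ... | yes _ = 2
  ... | no _  = 1

  width-inner : ∀ {i} → suc i < m → width (suc i) ≡ 2
  width-inner {i} lt with suc i <? m
  ... | yes _  = refl
  ... | no nlt = ⊥-elim (nlt lt)

  1≤width : ∀ i → 1 ≤ width i
  1≤width zero = ≤-refl
  1≤width (suc i) with suc i <? m
  ... | yes _ = s≤s z≤n
  ... | no _  = ≤-refl

  width≤2 : ∀ i → width i ≤ 2
  width≤2 zero = s≤s z≤n
  width≤2 (suc i) with suc i <? m
  ... | yes _ = ≤-refl
  ... | no _  = s≤s z≤n

  lo+width≤m : ∀ {i} → i ≤ m → lo i + width i ≤ m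
  lo+width≤m {zero} _ = <⇒≤ 2≤m
  lo+width≤m {suc i} i<m with suc i <? m
  ... | yes lt = subst (_≤ m) (sym (+-comm i 2)) lt
  ... | no _   = subst (_≤ m) (sym (+-comm i 1)) i<m

  Away : ℕ → ℕ → Set
  Away i = Outside (lo i) (width i)

  away : ∀ {i} y → i ≤ m → Away i y ⊎ (i < m × i ≡ y) ⊎ i ≡ suc y
  away {zero} zero    _ = inj₂ (inj₁ (<⇒≤ 2≤m , refl))
  away {zero} (suc y) _ = inj₁ (inj₂ (s≤s z≤n))
  away {suc i} y i<m with <-cmp y i
  ... | tri< y<i _ _ = inj₁ (inj₁ y<i)
  ... | tri≈ _ y≡i _ = inj₂ (inj₂ (cong suc (sym y≡i)))
  ... | tri> _ _ i<y with suc i <? m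
  ...   | no _   = inj₁ (inj₂ (subst (_≤ y) (sym (+-comm i 1)) i<y))
  ...   | yes lt with suc i ≟ y
  ...     | yes eq = inj₂ (inj₁ (lt , eq))
  ...     | no neq = inj₁ (inj₂ (subst (_≤ y) (sym (+-comm i 2)) (≤∧≢⇒< i<y neq)))

  away⇒≢ : ∀ {i y} → i < m → Away i y → y ≢ i
  away⇒≢ {zero}  i<m (inj₂ ()) refl
  away⇒≢ {suc i} i<m (inj₁ lt) refl = <⇒≱ lt (n≤1+n i)
  away⇒≢ {suc i} i<m (inj₂ le) refl rewrite width-inner i<m =
    <⇒≱ (n<1+n (suc i)) (subst (_≤ suc i) (+-comm i 2) le)

  away-suc⇒≢ : ∀ {i y} → Away (suc i) y → y ≢ i
  away-suc⇒≢ (inj₁ lt) refl = <-irrefl refl lt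
  away-suc⇒≢ {i} (inj₂ le) refl =
    <⇒≱ (n<1+n i) (≤-trans (subst (_≤ i + width (suc i)) (+-comm i 1) (+-monoʳ-≤ i (1≤width (suc i)))) le)

  -- With off = m the centre of every copy may serve as a b-vertex; off = m − 1 shifts the colours
  -- m, …, K − 1 to the inner copies, whose centres alone have degree t + 2.
  hub : ℕ → ℕ
  hub i = (off + i) ⊓ (K ∸ 1)

  m≤K∸1 : m ≤ K ∸ 1
  m≤K∸1 = ∸-monoˡ-≤ 1 m<K

  hub<K : ∀ i → hub i < K
  hub<K i = ≤-<-trans (m⊓n≤n (off + i) (K ∸ 1)) (∸-monoʳ-< {K} (s≤s z≤n) (≤-trans (s≤s z≤n) m<K))

  -- The interval ends at or below `m`, hence below neither the cap `K ∸ 1` nor, for positive `i`,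
  -- the sum `off + i` is exceeded; for `i = 0` it ends at 1. So the centre avoids the adjacent
  -- inserted colours, and `skip` applies.
  lo+width≤hub : ∀ {i} → i ≤ m → lo i + width i ≤ hub i
  lo+width≤hub {i} i≤m = ⊓-glb (bound i i≤m) (≤-trans (lo+width≤m i≤m) m≤K∸1)
    where
    bound : ∀ i → i ≤ m → lo i + width i ≤ off + i
    bound zero    _   = ≤-trans (s≤s⁻¹ (≤-trans 2≤m m≤1+off)) (m≤m+n off 0)
    bound (suc i) i<m = ≤-trans (lo+width≤m i<m)
      (≤-trans m≤1+off (subst (suc off ≤_) (sym (+-suc off i)) (s≤s (m≤m+n off i))))

  hub-hits : ∀ {i x} → off + i ≡ x → x < K → hub i ≡ x
  hub-hits {i} {x} eq x<K = trans (m≤n⇒m⊓n≡m (subst (_≤ K ∸ 1) (sym eq) (∸-monoˡ-≤ 1 x<K))) eq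

  -- Index of the last leaf colour: `width i` adjacent colours and the hub are excluded, and indices
  -- start at 0. Surplus leaves repeat that colour.
  cap : ℕ → ℕ
  cap i = K ∸ (2 + width i)

  2+width≤K : ∀ i → 2 + width i ≤ K
  2+width≤K i = ≤-trans (+-monoʳ-≤ 2 (width≤2 i)) 4≤K

  leaves : ℕ → ℕ → ℕ
  leaves i j = skip (lo i) (width i) (hub i) (j ⊓ cap i)

  leaves<K : ∀ i j → leaves i j < K
  leaves<K i j = begin-strict
    leaves i j                   ≤⟨ skip-≤ (lo i) (width i) (hub i) (j ⊓ cap i) ⟩
    suc (j ⊓ cap i + width i)    ≤⟨ s≤s (+-monoˡ-≤ (width i) (m⊓n≤n j (cap i))) ⟩
    suc (cap i + width i)        <⟨ n<1+n _ ⟩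
    2 + (cap i + width i)        ≡⟨ sym (trans (+-suc (cap i) _) (cong suc (+-suc (cap i) _))) ⟩
    cap i + (2 + width i)        ≡⟨ m∸n+n≡m (2+width≤K i) ⟩
    K                            ∎
    where open ≤-Reasoning

  -- Apart from the hub and the adjacent colours, `K ∸ 1 ∸ width i` colours remain; the upper bound
  -- on `K` lets `t` leaves show them all.
  leaves-onto : ∀ {i y} → i ≤ m → K ≤ suc (t + width i) → y < K → Away i y → y ≢ hub i →
                ∃[ j ] j < t × leaves i j ≡ y
  leaves-onto {i} {y} i≤m K≤ y<K aw y≢hub
    with x , eq , bound ← skip-onto (lo+width≤hub i≤m) (hub<K i) y<K aw y≢hub =
    x , +-cancelʳ-≤ (width i) (suc x) t (s≤s⁻¹ (≤-trans bound K≤)) ,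
    trans (cong (skip (lo i) (width i) (hub i)) (m≤n⇒m⊓n≡m x≤cap)) eq
    where
    x≤cap : x ≤ cap i
    x≤cap = m+n≤o⇒m≤o∸n x (subst (_≤ K) (sym (trans (+-suc x _) (cong suc (+-suc x _)))) bound)

  -- e_{i+1} sees i through the original vertex u_{i+2}, and e_0 sees 1 through u_0.
  base : ℕ → ℕ
  base zero          = 1
  base (suc zero)    = 2
  base (suc (suc i)) = i

  slot : ℕ → ℕ → ℕ
  slot i zero          = base i
  slot i (suc zero)    = hub i
  slot i (suc (suc j)) = leaves i j

  base<K : ∀ {i} → i ≤ m → base i < K
  base<K {zero}        _   = ≤-trans (s≤s (s≤s z≤n)) 4≤K
  base<K {suc zero}    _   = ≤-trans (s≤s (s≤s (s≤s z≤n))) 4≤K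
  base<K {suc (suc i)} i≤m = <-trans (≤-trans (n<1+n _) (≤-trans (n≤1+n (suc i)) i≤m)) m<K

  base≢ : ∀ i → base i ≢ i
  base≢ zero          ()
  base≢ (suc zero)    ()
  base≢ (suc (suc i)) eq = <⇒≢ (<-trans (n<1+n i) (n<1+n (suc i))) eq

  base-suc≢ : ∀ i → base (suc i) ≢ i
  base-suc≢ zero    ()
  base-suc≢ (suc i) eq = <⇒≢ (n<1+n i) eq

  slot<K : ∀ {i} s → i ≤ m → slot i s < K
  slot<K {i} zero          i≤m = base<K i≤m
  slot<K {i} (suc zero)    _   = hub<K i
  slot<K {i} (suc (suc j)) _   = leaves<K i j

  slot-away : ∀ {i} s → i ≤ m → Away i (slot i (suc s))
  slot-away zero    i≤m = inj₂ (lo+width≤hub i≤m)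
  slot-away {i} (suc j) i≤m = skip-outside (lo i) (width i) (hub i) (j ⊓ cap i)

  K≤-inner : ∀ {i} → suc i < m → K ≤ suc (t + width (suc i))
  K≤-inner lt = subst (K ≤_)
    (trans (cong suc (+-comm 2 t)) (cong (λ w → suc (t + w)) (sym (width-inner lt)))) K≤3+t

  copy-sees : ∀ {i y} → suc i < m → y < K → Away (suc i) y → ∃[ s ] s < 2 + t × slot (suc i) s ≡ y
  copy-sees {i} {y} lt y<K aw with y ≟ hub (suc i)
  ... | yes eq  = 1 , s≤s (s≤s z≤n) , sym eq
  ... | no y≢ with leaves-onto (<⇒≤ lt) (K≤-inner lt) y<K aw y≢
  ...   | j , j<t , eq = 2 + j , s≤s (s≤s j<t) , eq

  open Domination m t (λ i → i) slot

  -- The copy of `u_x`, or that of `u_1` if `x = 0`, is inner and shows every colour except those of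
  -- its two inserted neighbours. One of these is `x`; the other is supplied by `base`.
  edgeSees : ∀ {x y} → x < m → y < K → y ≢ x → EdgeSees x y
  edgeSees {zero} {y} _ y<K y≢0 with away {1} y (<⇒≤ 2≤m)
  ... | inj₁ aw with s , s< , eq ← copy-sees 2≤m y<K aw = s , s< , inj₂ eq
  ... | inj₂ (inj₁ (_ , 1≡y)) = 0 , s≤s z≤n , inj₁ 1≡y
  ... | inj₂ (inj₂ 1≡1+y)     = ⊥-elim (y≢0 (sym (suc-injective 1≡1+y)))
  edgeSees {suc x} {y} x<m y<K y≢x with away {suc x} y (<⇒≤ x<m)
  ... | inj₁ aw with s , s< , eq ← copy-sees x<m y<K aw = s , s< , inj₁ eq
  ... | inj₂ (inj₁ (_ , x≡y)) = ⊥-elim (y≢x (sym x≡y))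
  ... | inj₂ (inj₂ x≡1+y)     = 0 , s≤s z≤n , inj₂ (suc-injective x≡1+y)

  scheme : Scheme m t K
  scheme = record
    { edge          = λ i → i
    ; slot          = slot
    ; edge<         = λ i<m → <-trans i<m m<K
    ; slot<         = λ {i} → slot<K {i}
    ; slot≢edge     = λ where
        zero    i<m → base≢ _
        (suc s) i<m → away⇒≢ i<m (slot-away s (<⇒≤ i<m))
    ; slot-suc≢edge = λ where
        zero    i<m → base-suc≢ _
        (suc s) i<m → away-suc⇒≢ (slot-away s i<m)
    ; centre≢leaf   = λ {i} j i≤m eq → skip≢ {lo i} {width i} (j ⊓ cap i) (lo+width≤hub i≤m) (sym eq)
    ; dominating    = dominating
    }
    where
    dominating : ∀ {x} → x < K → Dominated K x
    dominating {x} x<K with x <? m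
    ... | yes x<m = inj₁ (x , x<m , refl , λ {y} → edgeSees {x} {y} x<m)
    ... | no x≮m with centres (≮⇒≥ x≮m) x<K
    ...   | i , i≤m , off+i≡x , full = inj₂ (i , i≤m , hub≡x , λ {y} → centreSees {y})
      where
      hub≡x : hub i ≡ x
      hub≡x = hub-hits off+i≡x x<K

      K≤ : ∀ {i} → K ≤ 2 + t ⊎ (0 < i × i < m) → K ≤ suc (t + width i)
      -- Even an end centre has one inserted neighbour besides its `t` leaves.
      K≤ {i} (inj₁ le) = ≤-trans le (s≤s (subst (_≤ t + width i) (+-comm t 1) (+-monoʳ-≤ t (1≤width i))))
      K≤ {suc i} (inj₂ (_ , lt)) = K≤-inner lt

      centreSees : ∀ {y} → y < K → y ≢ x → CentreSees i y
      centreSees {y} y<K y≢x with away {i} y i≤m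
      ... | inj₁ aw           = inj₁ (leaves-onto i≤m (K≤ full) y<K aw (λ eq → y≢x (trans eq hub≡x)))
      ... | inj₂ (inj₁ i≡y)   = inj₂ (inj₁ i≡y)
      ... | inj₂ (inj₂ i≡1+y) = inj₂ (inj₂ (y , i≡1+y , refl))

-- Colourings with at most n − 1 colours

halve : ∀ d → ∃[ j ] (d ≡ 2 * j ⊎ d ≡ suc (2 * j))
halve zero = 0 , inj₁ refl
halve (suc d) with halve d
... | j , inj₁ eq = j , inj₂ (cong suc eq)
... | j , inj₂ eq = suc j , inj₁ (trans (cong suc eq) (sym (*-suc 2 j)))

-- Adding `d` to the residue of `m` either stays below `n` and increases it, or wraps around and,
-- since `d < n`, decreases it.
[m+d]%n≢m%n : ∀ {n} .{{_ : NonZero n}} m {d} → 0 < d → d < n → (m + d) % n ≢ m % n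
[m+d]%n≢m%n {n} m {d} 0<d d<n eq with m % n + d <? n
... | yes r+d<n = <⇒≢ (m<m+n (m % n) 0<d)
  (sym (trans (sym (m<n⇒m%n≡m r+d<n)) (trans (sym [m+d]%n≡[m%n+d]%n) eq)))
  where
  [m+d]%n≡[m%n+d]%n : (m + d) % n ≡ (m % n + d) % n
  [m+d]%n≡[m%n+d]%n = trans (%-distribˡ-+ m d n) (cong (λ e → (m % n + e) % n) (m<n⇒m%n≡m d<n))
... | no r+d≮n = <⇒≱ smaller (subst (_≤ m % n + d ∸ n) wrapped (m%n≤m (m % n + d ∸ n) n))
  where
  n≤r+d : n ≤ m % n + d
  n≤r+d = ≮⇒≥ r+d≮n

  wrapped : (m % n + d ∸ n) % n ≡ m % n
  wrapped = trans (m≤n⇒[n∸m]%m≡n%m n≤r+d)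
    (trans (cong (λ e → (m % n + e) % n) (sym (m<n⇒m%n≡m d<n))) (trans (sym (%-distribˡ-+ m d n)) eq))

  smaller : m % n + d ∸ n < m % n
  smaller = subst (m % n + d ∸ n <_) (m+n∸n≡m (m % n) n) (∸-monoˡ-< (+-monoʳ-< (m % n) d<n) n≤r+d)

-- A slot of offset o shows `e_i` the differences o, through `u_i`, and o + 1, through `u_{i+1}`.
-- Properness therefore keeps offsets between 1 and K - 2, which is `L`, and `2 + t` slots reach at
-- most 2t + 4 nonzero differences, whence the bound on `L`.
module Cyclic {m t L : ℕ} (2≤L : 2 ≤ L) (2+L≤m : 2 + L ≤ m) (L≤3+2t : L ≤ 3 + 2 * t) where

  K : ℕ
  K = 2 + L

  -- The offsets 1, 3, 5, … (capped at K − 2) together with their successors are all the nonzero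
  -- residues modulo K.
  offset : ℕ → ℕ
  offset zero    = L
  offset (suc j) = suc (2 * j) ⊓ L

  offset≤L : ∀ s → offset s ≤ L
  offset≤L zero    = ≤-refl
  offset≤L (suc j) = m⊓n≤n (suc (2 * j)) L

  offset>0 : ∀ s → 0 < offset s
  offset>0 zero    = <⇒≤ 2≤L
  offset>0 (suc j) = ⊓-glb (s≤s z≤n) (<⇒≤ 2≤L)

  slot : ℕ → ℕ → ℕ
  slot i s = (i + offset s) % K

  -- Slot 0 reaches `L` and `suc L`. A smaller `d` is either an odd offset or the successor of one,
  -- and `L ≤ 3 + 2 * t` guarantees that its slot exists.
  reach : ∀ {d} → 0 < d → d < K → ∃[ s ] s < 2 + t × (offset s ≡ d ⊎ suc (offset s) ≡ d)
  reach {d} 0<d d<K with d ≟ suc L | d ≟ L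
  ... | yes refl | _        = 0 , s≤s z≤n , inj₂ refl
  ... | no _     | yes refl = 0 , s≤s z≤n , inj₁ refl
  ... | no d≢1+L | no d≢L   = odd d 0<d (≤∧≢⇒< (s≤s⁻¹ (≤∧≢⇒< (s≤s⁻¹ d<K) d≢1+L)) d≢L)
    where
    uncapped : ∀ {j} → suc (2 * j) < L → suc j < 2 + t × offset (suc j) ≡ suc (2 * j)
    uncapped {j} lt = s≤s (*-cancelˡ-< 2 j (suc t)
        (subst (2 * j <_) (sym (*-suc 2 t)) (s≤s⁻¹ (<-≤-trans lt L≤3+2t)))) ,
      m≤n⇒m⊓n≡m (<⇒≤ lt)

    odd : ∀ d → 0 < d → d < L → ∃[ s ] s < 2 + t × (offset s ≡ d ⊎ suc (offset s) ≡ d)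
    odd (suc d) _ d<L with halve d
    ... | j , inj₁ refl with s< , eq ← uncapped {j} d<L = suc j , s< , inj₁ eq
    ... | j , inj₂ refl with s< , eq ← uncapped {j} (<-trans (n<1+n _) d<L) = suc j , s< , inj₂ (cong suc eq)

  difference : ∀ {x y} → x < K → y < K → y ≢ x → ∃[ d ] 0 < d × d < K × (x + d) % K ≡ y
  difference {x} {y} x<K y<K y≢x with <-cmp x y
  ... | tri≈ _ x≡y _ = ⊥-elim (y≢x (sym x≡y))
  ... | tri< x<y _ _ = y ∸ x , m<n⇒0<n∸m x<y , ≤-<-trans (m∸n≤m y x) y<K ,
    trans (cong (_% K) (m+[n∸m]≡n (<⇒≤ x<y))) (m<n⇒m%n≡m y<K)
  ... | tri> _ _ y<x = (K ∸ x) + y , ≤-trans (m<n⇒0<n∸m x<K) (m≤m+n (K ∸ x) y) ,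
    subst (K ∸ x + y <_) (m∸n+n≡m (<⇒≤ x<K)) (+-monoʳ-< (K ∸ x) y<x) ,
    trans (cong (_% K) x+[K∸x]+y≡y+K) (trans ([m+n]%n≡m%n y K) (m<n⇒m%n≡m y<K))
    where
    x+[K∸x]+y≡y+K : x + (K ∸ x + y) ≡ y + K
    x+[K∸x]+y≡y+K = trans (sym (+-assoc x (K ∸ x) y))
      (trans (cong (_+ y) (m+[n∸m]≡n (<⇒≤ x<K))) (+-comm K y))

  scheme : Scheme m t K
  scheme = record
    { edge          = _% K
    ; slot          = slot
    ; edge<         = λ {i} _ → m%n<n i K
    ; slot<         = λ {i} s _ → m%n<n (i + offset s) K
    ; slot≢edge     = λ {i} s _ → [m+d]%n≢m%n i (offset>0 s) (s≤s (m≤n⇒m≤1+n (offset≤L s)))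
    ; slot-suc≢edge = λ {i} s _ eq → [m+d]%n≢m%n {K} i {suc (offset s)} (s≤s z≤n) (s≤s (s≤s (offset≤L s)))
        (trans (cong (_% K) (+-suc i (offset s))) eq)
    ; centre≢leaf   = λ {i} j _ → centre≢leaf i j
    ; dominating    = λ {x} x<K → inj₁ (x , <-≤-trans x<K 2+L≤m , m<n⇒m%n≡m x<K , edgeSees x<K)
    }
    where
    open Domination m t (_% K) slot

    -- The centre has offset 1 and the leaves have offsets from 2 to `L`, so the two differ by a
    -- number strictly between 0 and `K`.
    centre≢leaf : ∀ i j → slot i 1 ≢ slot i (2 + j)
    centre≢leaf i j eq = [m+d]%n≢m%n {K} (i + 1) {offset (2 + j) ∸ 1}
      (m<n⇒0<n∸m 1<offset) (s≤s (≤-trans (m∸n≤m (offset (2 + j)) 1) (m≤n⇒m≤1+n (offset≤L (2 + j)))))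
      (trans (cong (_% K) (trans (+-assoc i 1 _) (cong (i +_) (m+[n∸m]≡n (<⇒≤ 1<offset)))))
        (trans (sym eq) (cong (λ o → (i + o) % K) (m≤n⇒m⊓n≡m (<⇒≤ 2≤L)))))
      where
      1<offset : 1 < offset (2 + j)
      1<offset = ⊓-glb (s≤s (s≤s z≤n)) 2≤L

    edgeSees : ∀ {x} → x < K → ∀ {y} → y < K → y ≢ x → EdgeSees x y
    edgeSees {x} x<K y<K y≢x with difference x<K y<K y≢x
    ... | d , 0<d , d<K , eq with reach 0<d d<K
    ...   | s , s< , inj₁ refl = s , s< , inj₁ eq
    ...   | s , s< , inj₂ refl = s , s< , inj₂ (trans (cong (_% K) (sym (+-suc x (offset s)))) eq)

-- The five ranges of n

-- With `off = m` the colours from `m` on fall to the centres of `u_0`, `u_1`, and so on;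
-- `K ≤ m + suc m` keeps them within the path.
rigid-colouring : ∀ {m t K} → 2 ≤ m → m < K → 4 ≤ K → K ≤ 2 + t → K ≤ m + suc m →
                  BColouring (path (suc m) ⊡ star t) K
rigid-colouring {m} {t} {K} 2≤m m<K 4≤K K≤2+t K≤2m+1 = scheme⇒bColouring {m} {t} {K}
  (Rigid.scheme {off = m} 2≤m m<K 4≤K (m≤n⇒m≤1+n K≤2+t) (n≤1+n m) λ {x} m≤x x<K →
    x ∸ m , s≤s⁻¹ (m<n+o⇒m∸n<o x m (<-≤-trans x<K K≤2m+1)) , m+[n∸m]≡n m≤x , inj₁ K≤2+t)

-- With `suc m` inserted vertices, `off = m` starts the centres at `u_1`, and `K ≤ suc m + m` stops
-- them before the last copy.
rigid-colouring-inner : ∀ {m t K} → 2 ≤ suc m → suc m < K → 4 ≤ K → K ≤ 3 + t → K ≤ suc m + m →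
                        BColouring (path (suc (suc m)) ⊡ star t) K
rigid-colouring-inner {m} {t} {K} 2≤1+m m<K 4≤K K≤3+t K≤2m+1 = scheme⇒bColouring {suc m} {t} {K}
  (Rigid.scheme {off = m} 2≤1+m m<K 4≤K K≤3+t ≤-refl λ {x} m<x x<K →
    let x∸m<1+m = m<n+o⇒m∸n<o x m (subst (x <_) (sym (+-suc m m)) (<-≤-trans x<K K≤2m+1))
    in x ∸ m , <⇒≤ x∸m<1+m , m+[n∸m]≡n (<⇒≤ m<x) , inj₂ (m<n⇒0<n∸m m<x , x∸m<1+m))

cyclic-colouring : ∀ {m t K} → 4 ≤ K → K ≤ m → K ≤ 5 + 2 * t → BColouring (path (suc m) ⊡ star t) K
cyclic-colouring {K = suc zero} (s≤s ()) _ _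
cyclic-colouring {m} {t} {suc (suc L)} 4≤K K≤m K≤5+2t =
  scheme⇒bColouring {m} {t} {suc (suc L)}
    (Cyclic.scheme {m} {t} {L} (s≤s⁻¹ (s≤s⁻¹ 4≤K)) K≤m (s≤s⁻¹ (s≤s⁻¹ K≤5+2t)))

2*m≡m+m : ∀ m → 2 * m ≡ m + m
2*m≡m+m m = cong (m +_) (+-identityʳ m)

n≤2*⌈n/2⌉ : ∀ n → n ≤ 2 * ⌈ n /2⌉
n≤2*⌈n/2⌉ n = begin
  n                      ≡⟨ ⌊n/2⌋+⌈n/2⌉≡n n ⟨
  ⌊ n /2⌋ + ⌈ n /2⌉      ≤⟨ +-monoˡ-≤ ⌈ n /2⌉ (⌊n/2⌋≤⌈n/2⌉ n) ⟩
  ⌈ n /2⌉ + ⌈ n /2⌉      ≡⟨ 2*m≡m+m ⌈ n /2⌉ ⟨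
  2 * ⌈ n /2⌉            ∎
  where open ≤-Reasoning

2*⌈n/2⌉≤1+n : ∀ n → 2 * ⌈ n /2⌉ ≤ suc n
2*⌈n/2⌉≤1+n n = begin
  2 * ⌈ n /2⌉                ≡⟨ 2*m≡m+m ⌈ n /2⌉ ⟩
  ⌈ n /2⌉ + ⌈ n /2⌉          ≤⟨ +-monoʳ-≤ ⌈ n /2⌉ (⌈n/2⌉-mono (n≤1+n n)) ⟩
  ⌊ suc n /2⌋ + ⌈ suc n /2⌉  ≡⟨ ⌊n/2⌋+⌈n/2⌉≡n (suc n) ⟩
  suc n                      ∎
  where open ≤-Reasoning

-- Here n = m + 2, so there are `suc m` inserted vertices and `m` inner copies. The ranges are given
-- by bounds on 2n where the theorem has halves.
module Cases (m t : ℕ) (2≤m : 2 ≤ suc m) (2<t : 2 < t) where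

  φ≡ : ℕ → Set
  φ≡ = IsBChromaticNumber (path (suc (suc m)) ⊡ star t)

  1<t : 1 < t
  1<t = <⇒≤ 2<t

  4≤2+t : 4 ≤ 2 + t
  4≤2+t = +-monoʳ-≤ 2 1<t

  4≤3+t : 4 ≤ 3 + t
  4≤3+t = m≤n⇒m≤1+n 4≤2+t

  3+t≤5+2t : 3 + t ≤ 5 + 2 * t
  3+t≤5+2t = +-mono-≤ {3} {5} {t} {2 * t} (s≤s (s≤s (s≤s z≤n))) (m≤m+n t (t + 0))

  2*[2+m]≡ : 2 * (2 + m) ≡ 3 + (suc m + m)
  2*[2+m]≡ = trans (2*m≡m+m (2 + m)) (cong (2 +_) (trans (+-suc m (suc m)) (cong suc (+-suc m m))))

  2n≤3+t⇒ : 2 * (2 + m) ≤ 3 + t → φ≡ (2 * (2 + m) ∸ 1)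
  2n≤3+t⇒ le = subst φ≡ (cong (suc m +_) (sym (+-identityʳ (2 + m))))
    ( rigid-colouring 2≤m (m<m+n (suc m) (s≤s z≤n)) 4≤v
        (s≤s⁻¹ (subst (λ x → suc m + x < 3 + t) (+-identityʳ (2 + m)) le)) ≤-refl
    , λ k β → [ (λ k≤4 → ≤-trans k≤4 4≤v) , (λ k≤ → k≤) ]′ (Upper.≤inserted+centres {suc m} {t} {k} β))
    where
    4≤v : 4 ≤ suc m + (2 + m)
    4≤v = +-mono-≤ 2≤m (s≤s (s≤s z≤n))

  -- The hypotheses say that n = ⌈(t + 4)/2⌉. Beyond t + 2 colours only (n - 1) + (n - 2) vertices
  -- could be b-vertices, and 2n - 3 ≤ t + 2.
  4+t≤2n≤5+t⇒ : 4 + t ≤ 2 * (2 + m) → 2 * (2 + m) ≤ 5 + t → φ≡ (2 + t)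
  4+t≤2n≤5+t⇒ ≥4+t ≤5+t = rigid-colouring 2≤m (+-cancelˡ-≤ 3 _ _ n<2+t) 4≤2+t ≤-refl (+-cancelˡ-≤ 2 _ _ 2+t≤) ,
    λ k β → [ (λ k≤ → k≤)
            , (λ k≤ → ≤-trans k≤ (+-cancelˡ-≤ 3 _ _ (subst (_≤ 5 + t) 2*[2+m]≡ ≤5+t))) ]′
              (Upper.≤inserted+inner {suc m} {t} {k} β 1<t)
    where
    n<2+t : 3 + (2 + m) ≤ 3 + (2 + t)
    -- From n ≥ 3: n + 3 ≤ 2n ≤ t + 5.
    n<2+t = ≤-trans (s≤s (+-monoˡ-≤ (2 + m) 2≤m))
      (subst (_≤ 5 + t) (2*m≡m+m (2 + m)) ≤5+t)

    2+t≤ : 2 + (2 + t) ≤ 2 + (suc m + (2 + m))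
    2+t≤ = ≤-trans (subst (4 + t ≤_) (2*m≡m+m (2 + m)) ≥4+t) (n≤1+n _)

  4+t≤2m⇒ : 4 + t ≤ 2 * suc m → 2 + m ≤ 4 + t → φ≡ (3 + t)
  4+t≤2m⇒ 4+t≤2m n≤4+t = lower ,
    λ k β → [ (λ k≤ → k≤) , (λ k≤ → ≤-trans k≤ (s≤s⁻¹ n≤4+t)) ]′ (Upper.≤inserted {suc m} {t} {k} β 1<t)
    where
    lower : BColouring (path (suc (suc m)) ⊡ star t) (3 + t)
    lower with suc m <? 3 + t
    ... | yes lt = rigid-colouring-inner 2≤m lt 4≤3+t ≤-refl
      (s≤s⁻¹ (subst (4 + t ≤_) (trans (2*m≡m+m (suc m)) (cong suc (+-suc m m))) 4+t≤2m))
    -- Here n = t + 4: the inserted vertices are as many as the colours, and the cyclic pattern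
    -- takes over.
    ... | no nlt = cyclic-colouring 4≤3+t (≮⇒≥ nlt) 3+t≤5+2t

  4+t<n≤5+2t⇒ : 4 + t < 2 + m → 2 + m ≤ 5 + 2 * t → φ≡ (suc m)
  4+t<n≤5+2t⇒ (s≤s 4+t≤m) n≤ = cyclic-colouring (≤-trans (m≤m+n 4 t) 4+t≤m) ≤-refl (<⇒≤ n≤) ,
    λ k β → [ (λ k≤ → ≤-trans k≤ (<⇒≤ 4+t≤m)) , (λ k≤ → k≤) ]′ (Upper.≤inserted {suc m} {t} {k} β 1<t)

  5+2t<n⇒ : 5 + 2 * t < 2 + m → φ≡ (5 + 2 * t)
  5+2t<n⇒ (s≤s le) = cyclic-colouring (m≤m+n 4 _) le ≤-refl ,
    λ k β → subst (k ≤_) (cong suc (*-distribˡ-+ 2 2 t)) (Upper.≤maxDegree {suc m} {t} {k} β (<⇒≤ 1<t))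

n<⌈4+t/2⌉⇒2n≤3+t : ∀ {n t} → n < ⌈ 4 + t /2⌉ → 2 * n ≤ 3 + t
n<⌈4+t/2⌉⇒2n≤3+t {n} {t} n<h = +-cancelˡ-≤ 2 (2 * n) (3 + t) (begin
  2 + 2 * n            ≡⟨ *-suc 2 n ⟨
  2 * suc n            ≤⟨ *-monoʳ-≤ 2 n<h ⟩
  2 * ⌈ 4 + t /2⌉      ≤⟨ 2*⌈n/2⌉≤1+n (4 + t) ⟩
  5 + t                ∎)
  where open ≤-Reasoning

case-analysis : ∀ n t (P : ℕ → Set) →
  (2 * n ≤ 3 + t → P (2 * n ∸ 1)) →
  (4 + t ≤ 2 * n → 2 * n ≤ 5 + t → P (2 + t)) →
  (4 + t ≤ 2 * (n ∸ 1) → n ≤ 4 + t → P (3 + t)) →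
  (4 + t < n → n ≤ 5 + 2 * t → P (n ∸ 1)) →
  (5 + 2 * t < n → P (5 + 2 * t)) →
  P (if ⌊ 2 * n ≤? t + 3 ⌋ then 2 * n ∸ 1
    else if ⌊ n ≟ ⌈ t + 4 /2⌉ ⌋ then t + 2
    else if ⌊ ⌈ t + 4 /2⌉ <? n ⌋ ∧ ⌊ n ≤? t + 4 ⌋ then t + 3
    else if ⌊ t + 4 <? n ⌋ ∧ ⌊ n ≤? 2 * t + 5 ⌋ then n ∸ 1
    else 2 * t + 5)
case-analysis n t P c₁ c₂ c₃ c₄ c₅
  rewrite +-comm t 2 | +-comm t 3 | +-comm t 4 | +-comm (2 * t) 5
  with 2 * n ≤? 3 + t | n ≟ ⌈ 4 + t /2⌉ | ⌈ 4 + t /2⌉ <? n | n ≤? 4 + t | 4 + t <? n | n ≤? 5 + 2 * t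
... | yes 2n≤3+t | _ | _ | _ | _ | _ = c₁ 2n≤3+t
... | no _ | yes refl | _ | _ | _ | _ = c₂ (n≤2*⌈n/2⌉ (4 + t)) (2*⌈n/2⌉≤1+n (4 + t))
... | no _ | no _ | yes h<n | yes n≤4+t | _ | _ =
  c₃ (≤-trans (n≤2*⌈n/2⌉ (4 + t)) (*-monoʳ-≤ 2 (∸-monoˡ-≤ 1 h<n))) n≤4+t
... | no _ | no _ | yes _ | no _ | yes 4+t<n | yes n≤5+2t = c₄ 4+t<n n≤5+2t
... | no _ | no _ | yes _ | no _ | yes 4+t<n | no n≰5+2t  = c₅ (≰⇒> n≰5+2t)
... | no _ | no _ | yes _ | no n≰4+t | no 4+t≮n | _       = ⊥-elim (4+t≮n (≰⇒> n≰4+t))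
-- Below the ceiling the first test would have succeeded.
... | no 2n≰3+t | no n≢h | no h≮n | _ | _ | _             =
  ⊥-elim (2n≰3+t (n<⌈4+t/2⌉⇒2n≤3+t (≤∧≢⇒< (≮⇒≥ h≮n) n≢h)))

theorem8 : (n t : ℕ) → 2 < n → 2 < t →
    IsBChromaticNumber (path n ⊡ star t)
    (if ⌊ 2 * n ≤? t + 3 ⌋ then 2 * n ∸ 1
    else if ⌊ n ≟ ⌈ t + 4 /2⌉ ⌋ then t + 2
    else if ⌊ ⌈ t + 4 /2⌉ <? n ⌋ ∧ ⌊ n ≤? t + 4 ⌋ then t + 3
    else if ⌊ t + 4 <? n ⌋ ∧ ⌊ n ≤? 2 * t + 5 ⌋ then n ∸ 1
    else 2 * t + 5)
theorem8 (suc (suc m)) t (s≤s 2≤m) 2<t = case-analysis (suc (suc m)) t φ≡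
  2n≤3+t⇒ 4+t≤2n≤5+t⇒ 4+t≤2m⇒ 4+t<n≤5+2t⇒ 5+2t<n⇒
  where open Cases m t 2≤m 2<t
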